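{- (i) For all $i$, $n$, all $s,t\in\omega^n$ and all $\alpha,\beta$: $s\ast\alpha\sim^i_V t\ast\beta\leftrightarrow\alpha\sim^i_V\beta$. (ii) For all $i$ and all $\alpha,\beta$: $\alpha\sim^i_V\beta\rightarrow\alpha\sim^{i+1}_V\beta$. (iii) For all $i$ and all $\gamma$: $\neg\forall\alpha[\alpha\sim^{i+1}_V\gamma\rightarrow\alpha\sim^i_V\gamma]$. (iv) For all $i,j$ and all $\alpha,\beta,\gamma$: $(\alpha\sim^i_V\beta\wedge\beta\sim^j_V\gamma)\rightarrow\alpha\sim^{i+j}_V\gamma$. (v) $\sim^\omega_V$ is an equivalence relation on $\mathcal{N}$.
   Context: Intuitionistic mathematics (constructive reading of logical constants; Markov's Principle not assumed), with Brouwer's Continuity Principle as an axiom (for every $R\subseteq\mathcal{N}\times\omega$, if $\forall\alpha\exists n[\alpha Rn]$ then $\forall\alpha\exists m\exists n\forall\beta[\overline{\alpha}m\sqsubset\beta\rightarrow\beta Rn]$, where $\overline{\alpha}m=\langle\alpha(0),\dots,\alpha(m-1)\rangle$ and $\sqsubset$ is "initial segment of"). $\mathcal{N}=\omega^\omega$; $\omega^n$ is the set of finite sequences of length $n$; $s\ast\alpha$ is $s$ followed by $\alpha$. Relations: $\alpha\sim^0_V\beta$ iff $\exists n\forall m>n[\alpha(m)=\beta(m)]$ (the Vitali relation); $\alpha\sim^{i+1}_V\beta$ iff $\exists n\forall m>n[\alpha(m)\neq\beta(m)\rightarrow\alpha\sim^i_V\beta]$; $\alpha\sim^\omega_V\beta$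 iff $\exists i[\alpha\sim^i_V\beta]$. -}

module Defs where

open import Data.Fin using (toℕ)
open import Data.Nat using (ℕ; zero; suc; _>_)
open import Data.Product using (Σ)
open import Data.Vec using (Vec; []; _∷_; tabulate)
open import Function using (_∘_)
open import Relation.Binary.Definitions using () renaming (Irrelevant to PropositionValued)
open import Relation.Binary.PropositionalEquality using (_≡_; _≢_)
open import Relation.Nullary using (Irrelevant)

𝒩 : Set
𝒩 = ℕ → ℕ

infixr 5 _∗_

_∗_ : ∀ {n} → Vec ℕ n → 𝒩 → 𝒩
([]      ∗ α) k       = α k
((x ∷ s) ∗ α) zero    = x
((x ∷ s) ∗ α) (suc k) = (s ∗ α) k

-- overline α m is ⟨α(0),…,α(m-1)⟩.
overline : 𝒩 → (m : ℕ) → Vec ℕ m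
overline α m = tabulate (α ∘ toℕ)

infix 4 _⊏_

_⊏_ : ∀ {m} → Vec ℕ m → 𝒩 → Set
_⊏_ {m} s β = overline β m ≡ s

-- The existential quantifier of intuitionistic analysis cannot be read as Σ in
-- the presence of Brouwer's Continuity Principle: for R α n := (f α ≡ n) the
-- Σ-version yields a modulus-of-continuity functional for every f : 𝒩 → ℕ, and
-- this is refutable in type theory (Escardó), so everything that depends on the
-- principle would hold vacuously. "There exists" is therefore the
-- propositional truncation of Σ. Truncation is not definable in this type
-- theory, so it is given by its universal property, which determines it up to
-- logical equivalence.
record PropositionalTruncation : Set₁ where
  field
    ∥_∥    : Set → Set
    ∣_∣    : {A : Set} → A → ∥ A ∥
    squash : {A : Set} → Irrelevant ∥ A ∥
    rec    : {A B : Set} → Irrelevant B → (A → B) → ∥ A ∥ → B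

module Analysis (T : PropositionalTruncation) where

  open PropositionalTruncation T public

  infix 2 ∃-syntax

  ∃ : {A : Set} → (A → Set) → Set
  ∃ {A} P = ∥ Σ A P ∥

  ∃-syntax : {A : Set} → (A → Set) → Set
  ∃-syntax = ∃

  syntax ∃-syntax (λ x → P) = ∃[ x ] P

  -- A subset R of 𝒩 × ω is a proposition-valued relation. For arbitrary
  -- type-valued R the conclusion would also choose elements of R β n.
  BrouwerContinuityPrinciple : Set₁
  BrouwerContinuityPrinciple =
    (R : 𝒩 → ℕ → Set) → PropositionValued R →
    (∀ α → ∃[ n ] R α n) →
    ∀ α → ∃[ m ] ∃[ n ] (∀ β → overline α m ⊏ β → R β n)

  infix 4 _∼V[_]_ _∼Vω_

  _∼V[_]_ : 𝒩 → ℕ → 𝒩 → Set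
  α ∼V[ zero  ] β = ∃[ n ] (∀ m → m > n → α m ≡ β m)
  α ∼V[ suc i ] β = ∃[ n ] (∀ m → m > n → α m ≢ β m → α ∼V[ i ] β)

  _∼Vω_ : 𝒩 → 𝒩 → Set
  α ∼Vω β = ∃[ i ] α ∼V[ i ] β

{-# OPTIONS --safe #-}
-- Only (iii) needs the Continuity Principle. As δ ranges over 𝒩, perturb (i + 1) γ δ
-- changes γ in at most i + 1 places chosen by δ, so it is ∼^{i+1}-equivalent to γ.
-- If it were always ∼^i-equivalent to γ, continuity at δ = 0 would give a bound n
-- that works for every δ starting with enough zeros. Spending one of the i + 1 changes
-- beyond n and cutting off the initial segment leaves the same situation one level
-- lower, for a tail of γ. At level 0 the change beyond n is itself a contradiction.
module Submission where

open import Defs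
open import Data.Empty using (⊥; ⊥-elim)
open import Data.Fin.Properties using (toℕ<n)
open import Data.Nat using (ℕ; zero; suc; _+_; _<_; _>_; s≤s; s≤s⁻¹; _≟_)
open import Data.Nat.Properties using (+-suc; 1+n≢n; <-≤-trans; ≤-<-trans; m≤m+n; m≤n+m; m≤n⇒m≤1+n)
open import Data.Product using (_×_; _,_; map₂)
open import Data.Vec using (Vec; []; _∷_; replicate)
open import Data.Vec.Properties using (tabulate-cong)
open import Function using (_∘_; const)
open import Function.Bundles using (_⇔_; mk⇔)
open import Relation.Binary.PropositionalEquality using (_≡_; _≢_; refl; sym; trans; subst)
open import Relation.Binary.Structures using (IsEquivalence)
open import Relation.Nullary using (¬_; Irrelevant; yes; no)

bump : ℕ → ℕ → ℕ
bump zero    x = x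
bump (suc _) x = suc x

-- What is left of an allowance of `suc c` changes after one more entry of δ is read.
budget : ℕ → ℕ → ℕ
budget zero    c = suc c
budget (suc _) c = c

-- Adds 1 to γ at the first c places where δ is nonzero.
perturb : ℕ → 𝒩 → 𝒩 → 𝒩
perturb zero    γ δ k       = γ k
perturb (suc c) γ δ zero    = bump (δ 0) (γ 0)
perturb (suc c) γ δ (suc k) = perturb (budget (δ 0) c) (γ ∘ suc) (δ ∘ suc) k

-- Indistinguishable from the zero sequence before place k, it makes `perturb` spend exactly one
-- change at k and leaves the remaining ones to δ.
spike : ℕ → 𝒩 → 𝒩
spike k δ = replicate k 0 ∗ (1 ∷ []) ∗ δ

spike-below : ∀ {j k} δ → j < k → spike k δ j ≡ 0
spike-below {zero}  {suc k} δ _   = refl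
spike-below {suc j} {suc k} δ j<k = spike-below δ (s≤s⁻¹ j<k)

perturb-spike-≢ : ∀ c k γ δ → perturb (suc c) γ (spike k δ) k ≢ γ k
perturb-spike-≢ c zero    γ δ = 1+n≢n
perturb-spike-≢ c (suc k) γ δ = perturb-spike-≢ c k (γ ∘ suc) δ

+-<⁻ˡ : ∀ {m} a b → m > a + b → m > a
+-<⁻ˡ a b = ≤-<-trans (m≤m+n a b)

+-<⁻ʳ : ∀ {m} a b → m > a + b → m > b
+-<⁻ʳ a b = ≤-<-trans (m≤n+m b a)

module Vitali (T : PropositionalTruncation) where

  open Analysis T

  map : {A B : Set} → (A → B) → ∥ A ∥ → ∥ B ∥
  map f = rec squash (∣_∣ ∘ f)

  infixl 1 _>>=_

  _>>=_ : {A B : Set} → ∥ A ∥ → (A → ∥ B ∥) → ∥ B ∥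
  a >>= f = rec squash f a

  ∼-irrelevant : ∀ i {α β} → Irrelevant (α ∼V[ i ] β)
  ∼-irrelevant zero    = squash
  ∼-irrelevant (suc i) = squash

  ∼-cons : ∀ i α β → (α ∘ suc) ∼V[ i ] (β ∘ suc) → α ∼V[ i ] β
  ∼-cons zero    α β = map λ (n , p) → suc n , λ { (suc m) m>n → p m (s≤s⁻¹ m>n) }
  ∼-cons (suc i) α β = map λ (n , p) → suc n , λ { (suc m) m>n α≢β → ∼-cons i α β (p m (s≤s⁻¹ m>n) α≢β) }

  ∼-tail : ∀ i α β → α ∼V[ i ] β → (α ∘ suc) ∼V[ i ] (β ∘ suc)
  ∼-tail zero    α β = map λ (n , p) → n , λ m m>n → p (suc m) (m≤n⇒m≤1+n m>n)
  ∼-tail (suc i) α β = map λ (n , p) → n , λ m m>n α≢β → ∼-tail i α β (p (suc m) (m≤n⇒m≤1+n m>n) α≢β)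

  ∼-∗⁺ : ∀ i {n} (s t : Vec ℕ n) α β → α ∼V[ i ] β → s ∗ α ∼V[ i ] t ∗ β
  ∼-∗⁺ i []      []      α β p = p
  ∼-∗⁺ i (x ∷ s) (y ∷ t) α β p = ∼-cons i ((x ∷ s) ∗ α) ((y ∷ t) ∗ β) (∼-∗⁺ i s t α β p)

  ∼-∗⁻ : ∀ i {n} (s t : Vec ℕ n) α β → s ∗ α ∼V[ i ] t ∗ β → α ∼V[ i ] β
  ∼-∗⁻ i []      []      α β p = p
  ∼-∗⁻ i (x ∷ s) (y ∷ t) α β p = ∼-∗⁻ i s t α β (∼-tail i ((x ∷ s) ∗ α) ((y ∷ t) ∗ β) p)

  ∼-suc : ∀ i α β → α ∼V[ i ] β → α ∼V[ suc i ] β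
  ∼-suc i α β p = ∣ 0 , (λ _ _ _ → p) ∣

  ∼-refl : ∀ α → α ∼V[ 0 ] α
  ∼-refl α = ∣ 0 , (λ _ _ → refl) ∣

  ∼-sym : ∀ i α β → α ∼V[ i ] β → β ∼V[ i ] α
  ∼-sym zero    α β = map λ (n , p) → n , λ m m>n → sym (p m m>n)
  ∼-sym (suc i) α β = map λ (n , p) → n , λ m m>n β≢α → ∼-sym i α β (p m m>n (β≢α ∘ sym))

  -- Induction on both levels: beyond both bounds, a place where α and γ differ is one where α and
  -- β, or β and γ, differ, and this lowers i or j by one.
  ∼-trans : ∀ i j α β γ → α ∼V[ i ] β → β ∼V[ j ] γ → α ∼V[ i + j ] γ
  ∼-trans zero zero α β γ p q =
    p >>= λ (a , f) → q >>= λ (b , g) → ∣ a + b , (λ m m> →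
      trans (f m (+-<⁻ˡ a b m>)) (g m (+-<⁻ʳ a b m>))) ∣
  ∼-trans zero (suc j) α β γ p q =
    p >>= λ (a , f) → q >>= λ (b , g) → ∣ a + b , (λ m m> α≢γ →
      ∼-trans zero j α β γ p
        (g m (+-<⁻ʳ a b m>) (α≢γ ∘ trans (f m (+-<⁻ˡ a b m>))))) ∣
  ∼-trans (suc i) zero α β γ p q =
    p >>= λ (a , f) → q >>= λ (b , g) → ∣ a + b , (λ m m> α≢γ →
      ∼-trans i zero α β γ
        (f m (+-<⁻ˡ a b m>) λ α≡β → α≢γ (trans α≡β (g m (+-<⁻ʳ a b m>)))) q) ∣
  ∼-trans (suc i) (suc j) α β γ p q =
    p >>= λ (a , f) → q >>= λ (b , g) → ∣ a + b , step a f b g ∣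
    where
    step : ∀ a → (∀ m → m > a → α m ≢ β m → α ∼V[ i ] β) →
           ∀ b → (∀ m → m > b → β m ≢ γ m → β ∼V[ j ] γ) →
           ∀ m → m > a + b → α m ≢ γ m → α ∼V[ i + suc j ] γ
    step a f b g m m> α≢γ with α m ≟ β m
    -- Here j drops, so the recursive call lands at level `suc i + j` and has to be moved to
    -- `i + suc j`.
    ... | yes α≡β = subst (λ k → α ∼V[ k ] γ) (sym (+-suc i j))
                      (∼-trans (suc i) j α β γ p (g m (+-<⁻ʳ a b m>) (α≢γ ∘ trans α≡β)))
    ... | no  α≢β = ∼-trans i (suc j) α β γ (f m (+-<⁻ˡ a b m>) α≢β) q

  ∼ω-isEquivalence : IsEquivalence _∼Vω_
  ∼ω-isEquivalence = record
    { refl  = λ {α} → ∣ 0 , ∼-refl α ∣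
    ; sym   = λ {α} {β} → map λ (i , p) → i , ∼-sym i α β p
    ; trans = λ {α} {β} {γ} p q → p >>= λ (i , p′) → q >>= λ (j , q′) →
                ∣ i + j , ∼-trans i j α β γ p′ q′ ∣
    }

  -- A difference at m shows that δ has a nonzero entry at or before m. After the first such entry
  -- only c changes remain, so the bound 0 suffices.
  perturb-∼ : ∀ c γ δ → perturb c γ δ ∼V[ c ] γ
  perturb-∼ zero    γ δ = ∼-refl γ
  perturb-∼ (suc c) γ δ = ∣ 0 , (λ m _ → differs⇒∼ m γ δ) ∣
    where
    differs⇒∼ : ∀ m γ δ → perturb (suc c) γ δ m ≢ γ m → perturb (suc c) γ δ ∼V[ c ] γ
    differs⇒∼ m γ δ differs = ∼-cons c (perturb (suc c) γ δ) γ (tail m differs)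
      where
      tail : ∀ m → perturb (suc c) γ δ m ≢ γ m →
             perturb (budget (δ 0) c) (γ ∘ suc) (δ ∘ suc) ∼V[ c ] (γ ∘ suc)
      tail zero differs with δ 0
      ... | zero  = ⊥-elim (differs refl)
      ... | suc _ = perturb-∼ c (γ ∘ suc) (δ ∘ suc)
      tail (suc m) differs with δ 0
      ... | zero  = differs⇒∼ m (γ ∘ suc) (δ ∘ suc) differs
      ... | suc _ = perturb-∼ c (γ ∘ suc) (δ ∘ suc)

  perturb-spike-tail : ∀ i c k γ δ → perturb (suc c) γ (spike k δ) ∼V[ i ] γ →
                       perturb c (γ ∘ (suc k +_)) δ ∼V[ i ] (γ ∘ (suc k +_))
  perturb-spike-tail i c zero    γ δ p = ∼-tail i (perturb (suc c) γ (spike 0 δ)) γ p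
  perturb-spike-tail i c (suc k) γ δ p =
    perturb-spike-tail i c k (γ ∘ suc) δ (∼-tail i (perturb (suc c) γ (spike (suc k) δ)) γ p)

  module _ (bcp : BrouwerContinuityPrinciple) where

    -- `Q` stands for the relation one level lower, or for absurdity at level 0, so that one
    -- continuity argument serves both cases.
    uniform-spike : ∀ c γ {Q : 𝒩 → Set} → (∀ δ → Irrelevant (Q δ)) →
                    (∀ δ → ∃[ n ] (∀ m → m > n → perturb (suc c) γ δ m ≢ γ m → Q δ)) →
                    ∃[ k ] (∀ δ → Q (spike k δ))
    uniform-spike c γ {Q} Q-irrelevant H =
      -- Truncating `P` makes the relation proposition-valued; the truncation can be removed below
      -- because `Q` is a proposition.
      bcp (λ δ n → ∥ P δ n ∥) squash (map (map₂ ∣_∣) ∘ H) (const 0) >>= λ (m , ∃n) →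
      ∃n >>= λ (n , f) →
      -- Above n, so that the bound applies at k; at least m, so that the spike shares its first m
      -- entries with the zero sequence.
      let k = suc (m + n) in
      ∣ k , (λ δ → rec (Q-irrelevant (spike k δ))
                     (λ p → p k (s≤s (m≤n+m n m)) (perturb-spike-≢ c k γ δ))
                     (f (spike k δ) (tabulate-cong λ j →
                       spike-below δ (<-≤-trans (toℕ<n j) (m≤n⇒m≤1+n (m≤m+n m n)))))) ∣
      where
      P : 𝒩 → ℕ → Set
      P δ n = ∀ m → m > n → perturb (suc c) γ δ m ≢ γ m → Q δ

    ¬perturb-∼ : ∀ i γ → ¬ (∀ δ → perturb (suc i) γ δ ∼V[ i ] γ)
    ¬perturb-∼ zero γ H =
      rec (λ ()) (λ (_ , q) → q (const 0))
        -- Agreement beyond n is read as: any difference beyond n is absurd.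
        (uniform-spike 0 γ {Q = const ⊥} (λ _ ())
          λ δ → map (λ (n , p) → n , λ m m>n differs → differs (p m m>n)) (H δ))
    ¬perturb-∼ (suc i) γ H =
      rec (λ ())
        (λ (k , q) → ¬perturb-∼ i (γ ∘ (suc k +_)) λ δ → perturb-spike-tail i (suc i) k γ δ (q δ))
        (uniform-spike (suc i) γ (λ _ → ∼-irrelevant i) H)

theorem10p2 : (T : PropositionalTruncation) → let open Analysis T in
    BrouwerContinuityPrinciple →
    (∀ (i n : ℕ) (s t : Vec ℕ n) (α β : 𝒩) → (s ∗ α ∼V[ i ] t ∗ β) ⇔ (α ∼V[ i ] β))
    × (∀ (i : ℕ) (α β : 𝒩) → α ∼V[ i ] β → α ∼V[ suc i ] β)
    × (∀ (i : ℕ) (γ : 𝒩) → ¬ (∀ (α : 𝒩) → α ∼V[ suc i ] γ → α ∼V[ i ] γ))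
    × (∀ (i j : ℕ) (α β γ : 𝒩) → (α ∼V[ i ] β) × (β ∼V[ j ] γ) → α ∼V[ i + j ] γ)
    × IsEquivalence _∼Vω_
theorem10p2 T bcp =
    (λ i n s t α β → mk⇔ (∼-∗⁻ i s t α β) (∼-∗⁺ i s t α β))
  , ∼-suc
  , (λ i γ H → ¬perturb-∼ bcp i γ λ δ → H (perturb (suc i) γ δ) (perturb-∼ (suc i) γ δ))
  , (λ i j α β γ (p , q) → ∼-trans i j α β γ p q)
  , ∼ω-isEquivalence
  where open Vitali T
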